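{- Let $T$ be a pr-tree (a plane rooted tree) and let $T'$ be a pr-tree obtained from $T$ by a level one permutation. Then $T'$ and $T$ have the same parity, i.e. $T'$ is even if and only if $T$ is even.
   Context: A pr-tree (plane rooted tree) is a finite tree embedded in the plane with a chosen root vertex and a chosen marked edge incident to the root; it is drawn growing downwards from the root with the marked edge as the leftmost edge at the root. Equivalently, it is a rooted tree in which the children of every vertex are linearly ordered from left to right. The root is the vertex of level 0, its children are the vertices of level 1, and so on. Each level 1 vertex is the root of a pr-subtree of $T$. A level one permutation is any change of the left-to-right order of the level 1 vertices together with the pr-subtrees rooted at them (the subtrees themselves being unchanged). Bracket code: walk around the tree starting at the root, visiting the children of each vertex from left to right (depth-first); write an opening bracket when a vertex is met for the first time and a closing bracket when it is met for the last time. Thus, recursively, the code of a pr-tree whose root has pr-subtrees $T_1,\dots,T_s$ (left to right) is $(\,c(T_1)\cdots c(T_s)\,)$, where $c(T_i)$ is the code of $T_i$, and the one-vertex tree has code $()$. An inversion in a bracket code is a pair consisting of a closing bracket and an opening bracket, not necessarily adjacent, such that the closing bracket occurs before the opening bracket. A pr-tree is even if the number of inversions in its bracket code is even, and odd otherwise; this is its parity. -}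

module Defs where

open import Data.Fin using (Fin; _<_)
open import Data.Fin.Properties using (_<?_)
open import Data.List using (List; []; _∷_; _++_; [_]; length; lookup; filter; allFin; cartesianProduct)
open import Data.List.Relation.Binary.Permutation.Propositional using (_↭_)
open import Data.Nat using (ℕ)
open import Data.Nat.Divisibility using (_∣_)
open import Data.Product using (_×_; _,_)
open import Relation.Binary.Definitions using (DecidableEquality)
open import Relation.Binary.PropositionalEquality using (_≡_; refl)
open import Relation.Nullary using (Dec; yes; no)
open import Relation.Nullary.Decidable using (_×-dec_)

-- A plane rooted tree, given by the pr-subtrees at the children of its root,
-- listed from left to right.  (The library's Data.Tree.Rose uses sized types
-- and so is not available under --safe.)
data PRTree : Set where
  node : List PRTree → PRTree

data LevelOnePermutation : PRTree → PRTree → Set where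
  permute : ∀ {ts ts′} → ts ↭ ts′ → LevelOnePermutation (node ts) (node ts′)

data Bracket : Set where
  opening closing : Bracket

_≟_ : DecidableEquality Bracket
opening ≟ opening = yes refl
opening ≟ closing = no λ ()
closing ≟ opening = no λ ()
closing ≟ closing = yes refl

-- codes ts is the concatenation of the codes of the trees in ts; it is
-- written out instead of using concatMap so that termination is structural.
code  : PRTree → List Bracket
codes : List PRTree → List Bracket

code (node ts) = [ opening ] ++ codes ts ++ [ closing ]

codes []       = []
codes (t ∷ ts) = code t ++ codes ts

module _ (w : List Bracket) where

  Position : Set
  Position = Fin (length w)

  IsInversion : Position × Position → Set
  IsInversion (i , j) = i < j × lookup w i ≡ closing × lookup w j ≡ opening

  isInversion? : (p : Position × Position) → Dec (IsInversion p)
  isInversion? (i , j) = (i <? j) ×-dec (lookup w i ≟ closing) ×-dec (lookup w j ≟ opening)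

  inversions : ℕ
  inversions = length (filter isInversion? (cartesianProduct (allFin (length w)) (allFin (length w))))

EvenTree : PRTree → Set
EvenTree T = 2 ∣ inversions (code T)

{-# OPTIONS --safe #-}

-- For words u and v, the inversions of u ++ v are those of u, those of v, and
-- one for each closing bracket of u paired with each opening bracket of v.  A
-- code has as many opening as closing brackets, so this cross term is symmetric
-- for two codes, and exchanging adjacent subtrees preserves even the number of
-- inversions.
module Submission where

open import Defs
open import Data.Fin using (zero; suc)
open import Data.List using (List; []; _∷_; _++_; [_]; length; lookup; filter; map; tabulate; allFin; cartesianProduct)
open import Data.List.Properties using (length-++; filter-++; filter-none; map-tabulate; tabulate-lookup; map-++; map-∘)
open import Data.List.Relation.Binary.Permutation.Propositional using (_↭_; refl; prep; swap; trans; ↭-trans)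
open import Data.List.Relation.Binary.Permutation.Propositional.Properties using (++⁺ˡ; shifts; filter-↭; ↭-length)
open import Data.List.Relation.Unary.All using (universal)
open import Data.List.Relation.Unary.All.Properties using (map⁺)
open import Data.Nat using (ℕ; suc; _+_; _*_; s≤s; s≤s⁻¹; z≤n)
open import Data.Nat.Divisibility using (_∣_)
open import Data.Nat.Properties using (+-comm; +-identityʳ)
open import Data.Nat.Tactic.RingSolver using (solve-∀)
open import Data.Product using (_×_; _,_; proj₁; proj₂)
import Data.Product as Product
open import Function using (_∘_)
open import Function.Bundles using (_⇔_; mk⇔; module Equivalence)
open import Level using (0ℓ)
open import Relation.Binary.PropositionalEquality using (_≡_; refl; sym; cong; cong₂; subst; module ≡-Reasoning)
import Relation.Binary.PropositionalEquality as ≡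
open import Relation.Nullary using (¬_; yes; no; contradiction)
open import Relation.Unary using (Pred; Decidable)

open ≡-Reasoning

private
  variable
    A B C D : Set

count : {P : Pred A 0ℓ} → Decidable P → List A → ℕ
count P? xs = length (filter P? xs)

count-++ : {P : Pred A 0ℓ} (P? : Decidable P) (xs ys : List A) →
           count P? (xs ++ ys) ≡ count P? xs + count P? ys
count-++ P? xs ys = ≡.trans (cong length (filter-++ P? xs ys)) (length-++ (filter P? xs))

count-map : {P : Pred B 0ℓ} {Q : Pred A 0ℓ} (P? : Decidable P) (Q? : Decidable Q) (f : A → B) →
            (∀ x → P (f x) ⇔ Q x) → ∀ xs → count P? (map f xs) ≡ count Q? xs
count-map P? Q? f P⇔Q []       = refl
count-map P? Q? f P⇔Q (x ∷ xs) with P? (f x) | Q? x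
... | yes _ | yes _ = cong suc (count-map P? Q? f P⇔Q xs)
... | no  _ | no  _ = count-map P? Q? f P⇔Q xs
... | yes p | no ¬q = contradiction (Equivalence.to (P⇔Q x) p) ¬q
... | no ¬p | yes q = contradiction (Equivalence.from (P⇔Q x) q) ¬p

-- Each row of the product loses only its pair with `y`, which `P` rejects. This serves to discard
-- the pairs whose second position is `zero`, since no position lies before the first.
count-cartesianProduct-∷ʳ : {P : Pred (A × B) 0ℓ} (P? : Decidable P) {y : B} → (∀ x → ¬ P (x , y)) →
                            ∀ xs ys → count P? (cartesianProduct xs (y ∷ ys)) ≡ count P? (cartesianProduct xs ys)
count-cartesianProduct-∷ʳ P?     ¬P []       ys = refl
count-cartesianProduct-∷ʳ P? {y} ¬P (x ∷ xs) ys with P? (x , y)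
... | yes p = contradiction p (¬P x)
... | no  _ = begin
  count P? (map (x ,_) ys ++ cartesianProduct xs (y ∷ ys))
    ≡⟨ count-++ P? (map (x ,_) ys) _ ⟩
  count P? (map (x ,_) ys) + count P? (cartesianProduct xs (y ∷ ys))
    ≡⟨ cong (count P? (map (x ,_) ys) +_) (count-cartesianProduct-∷ʳ P? ¬P xs ys) ⟩
  count P? (map (x ,_) ys) + count P? (cartesianProduct xs ys)
    ≡⟨ count-++ P? (map (x ,_) ys) _ ⟨
  count P? (map (x ,_) ys ++ cartesianProduct xs ys) ∎

cartesianProduct-map : (f : A → C) (g : B → D) (xs : List A) (ys : List B) →
                       cartesianProduct (map f xs) (map g ys) ≡ map (Product.map f g) (cartesianProduct xs ys)
cartesianProduct-map f g []       ys = refl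
cartesianProduct-map f g (x ∷ xs) ys = begin
  map (f x ,_) (map g ys) ++ cartesianProduct (map f xs) (map g ys)
    -- Both mapped lists fuse to the single map sending `y` to `(f x , g y)`, so `map-∘` is used
    -- once in each direction.
    ≡⟨ cong₂ _++_ (≡.trans (sym (map-∘ ys)) (map-∘ ys)) (cartesianProduct-map f g xs ys) ⟩
  map (Product.map f g) (map (x ,_) ys) ++ map (Product.map f g) (cartesianProduct xs ys)
    ≡⟨ map-++ (Product.map f g) (map (x ,_) ys) _ ⟨
  map (Product.map f g) (map (x ,_) ys ++ cartesianProduct xs ys) ∎

occurrences : Bracket → List Bracket → ℕ
occurrences b = count (_≟ b)

openings closings : List Bracket → ℕ
openings = occurrences opening
closings = occurrences closing

IsInversion-suc : ∀ b w p → IsInversion (b ∷ w) (Product.map suc suc p) ⇔ IsInversion w p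
IsInversion-suc b w p = mk⇔ (Product.map₁ s≤s⁻¹) (Product.map₁ s≤s)

leadingInversions : Bracket → List Bracket → ℕ
leadingInversions b w = count (isInversion? (b ∷ w)) (map (λ j → zero , suc j) (allFin (length w)))

-- Pairs of positions split by whether the left one is the head `b`. No inversion ends at the head,
-- and pairs of successor positions form a shifted copy of the pairs of `w`.
inversions-∷ : ∀ b w → inversions (b ∷ w) ≡ leadingInversions b w + inversions w
inversions-∷ b w = begin
  count I? (cartesianProduct (allFin (suc n)) (zero ∷ tabulate suc))
    ≡⟨ count-cartesianProduct-∷ʳ I? {zero} (λ _ ()) (allFin (suc n)) (tabulate suc) ⟩
  count I? (cartesianProduct (zero ∷ tabulate suc) (tabulate suc))
    -- The tail of `allFin (suc n)` is `tabulate suc`; rewriting it as `map suc (allFin n)` in both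
    -- factors exposes the shift by `suc`.
    ≡⟨ cong (λ js → count I? (cartesianProduct (zero ∷ js) js)) (map-tabulate (λ i → i) suc) ⟨
  count I? (map (zero ,_) sucs ++ cartesianProduct sucs sucs)
    ≡⟨ count-++ I? (map (zero ,_) sucs) _ ⟩
  count I? (map (zero ,_) sucs) + count I? (cartesianProduct sucs sucs)
    ≡⟨ cong₂ _+_ (cong (count I?) (map-∘ (allFin n)))
                 (sym (cong (count I?) (cartesianProduct-map suc suc (allFin n) (allFin n)))) ⟨
  leadingInversions b w + count I? (map (Product.map suc suc) (cartesianProduct (allFin n) (allFin n)))
    ≡⟨ cong (leadingInversions b w +_) (count-map I? (isInversion? w) (Product.map suc suc) (IsInversion-suc b w)
         (cartesianProduct (allFin n) (allFin n))) ⟩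
  leadingInversions b w + inversions w ∎
  where
  n    = length w
  I?   = isInversion? (b ∷ w)
  sucs = map suc (allFin n)

leadingInversions-opening : ∀ w → leadingInversions opening w ≡ 0
leadingInversions-opening w = cong length (filter-none (isInversion? (opening ∷ w))
  (map⁺ (universal (λ { _ (_ , () , _) }) (allFin (length w)))))

-- With a closing bracket at position `zero`, the order and closing conditions hold automatically,
-- so only the condition that the later bracket is opening remains.
leadingInversions-closing : ∀ w → leadingInversions closing w ≡ openings w
leadingInversions-closing w = begin
  leadingInversions closing w
    ≡⟨ count-map (isInversion? (closing ∷ w)) (λ j → lookup w j ≟ opening) (λ j → zero , suc j)
         (λ _ → mk⇔ (proj₂ ∘ proj₂) (λ eq → s≤s z≤n , refl , eq)) (allFin (length w)) ⟩
  count (λ j → lookup w j ≟ opening) (allFin (length w))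
    -- Passes from counting positions to counting letters: reading `w` at all its positions gives
    -- back `w`.
    ≡⟨ count-map (_≟ opening) _ (lookup w) (λ _ → mk⇔ (λ eq → eq) (λ eq → eq)) (allFin (length w)) ⟨
  openings (map (lookup w) (allFin (length w)))
    ≡⟨ cong openings (≡.trans (map-tabulate (λ i → i) (lookup w)) (tabulate-lookup w)) ⟩
  openings w ∎

inversions-opening∷ : ∀ w → inversions (opening ∷ w) ≡ inversions w
inversions-opening∷ w =
  ≡.trans (inversions-∷ opening w) (cong (_+ inversions w) (leadingInversions-opening w))

inversions-closing∷ : ∀ w → inversions (closing ∷ w) ≡ openings w + inversions w
inversions-closing∷ w =
  ≡.trans (inversions-∷ closing w) (cong (_+ inversions w) (leadingInversions-closing w))

-- Induction on `u`. An opening head adds nothing on either side. A closing head adds the openings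
-- of `u ++ v`: those in `u` belong to the inversions of the longer left word, those in `v` enlarge
-- the cross term.
inversions-++ : ∀ u v → inversions (u ++ v) ≡ inversions u + inversions v + closings u * openings v
inversions-++ []            v = sym (+-identityʳ (inversions v))
inversions-++ (opening ∷ u) v = begin
  inversions (opening ∷ u ++ v)
    ≡⟨ inversions-opening∷ (u ++ v) ⟩
  inversions (u ++ v)
    ≡⟨ inversions-++ u v ⟩
  inversions u + inversions v + closings u * openings v
    ≡⟨ cong (λ k → k + inversions v + closings u * openings v) (inversions-opening∷ u) ⟨
  inversions (opening ∷ u) + inversions v + closings u * openings v ∎
inversions-++ (closing ∷ u) v = begin
  inversions (closing ∷ u ++ v)
    ≡⟨ inversions-closing∷ (u ++ v) ⟩
  openings (u ++ v) + inversions (u ++ v)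
    ≡⟨ cong₂ _+_ (count-++ (_≟ opening) u v) (inversions-++ u v) ⟩
  openings u + openings v + (inversions u + inversions v + closings u * openings v)
    ≡⟨ rearrange (openings u) (openings v) (inversions u) (inversions v) (closings u) ⟩
  openings u + inversions u + inversions v + suc (closings u) * openings v
    ≡⟨ cong (λ k → k + inversions v + suc (closings u) * openings v) (inversions-closing∷ u) ⟨
  inversions (closing ∷ u) + inversions v + suc (closings u) * openings v ∎
  where
  rearrange : ∀ ou ov iu iv cu → ou + ov + (iu + iv + cu * ov) ≡ ou + iu + iv + (1 + cu) * ov
  rearrange = solve-∀

code-balanced  : ∀ t → openings (code t) ≡ closings (code t)
codes-balanced : ∀ ts → openings (codes ts) ≡ closings (codes ts)

code-balanced (node ts) = begin
  suc (openings (codes ts ++ [ closing ]))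
    ≡⟨ cong suc (count-++ (_≟ opening) (codes ts) [ closing ]) ⟩
  suc (openings (codes ts) + 0)
    ≡⟨ cong suc (+-identityʳ (openings (codes ts))) ⟩
  suc (openings (codes ts))
    ≡⟨ cong suc (codes-balanced ts) ⟩
  suc (closings (codes ts))
    ≡⟨ +-comm 1 (closings (codes ts)) ⟩
  closings (codes ts) + 1
    ≡⟨ count-++ (_≟ closing) (codes ts) [ closing ] ⟨
  closings (codes ts ++ [ closing ]) ∎

codes-balanced []       = refl
codes-balanced (t ∷ ts) = begin
  openings (code t ++ codes ts)
    ≡⟨ count-++ (_≟ opening) (code t) (codes ts) ⟩
  openings (code t) + openings (codes ts)
    ≡⟨ cong₂ _+_ (code-balanced t) (codes-balanced ts) ⟩
  closings (code t) + closings (codes ts)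
    ≡⟨ count-++ (_≟ closing) (code t) (codes ts) ⟨
  closings (code t ++ codes ts) ∎

-- Inversions depend on the order of the brackets, so this alone does not settle them; it yields
-- that the number of opening brackets is invariant.
codes-↭ : ∀ {ts ts′} → ts ↭ ts′ → codes ts ↭ codes ts′
codes-↭ refl         = refl
codes-↭ (prep t p)   = ++⁺ˡ (code t) (codes-↭ p)
codes-↭ (swap s t p) = ↭-trans (shifts (code s) (code t)) (++⁺ˡ (code t) (++⁺ˡ (code s) (codes-↭ p)))
codes-↭ (trans p q)  = ↭-trans (codes-↭ p) (codes-↭ q)

openings-codes-↭ : ∀ {ts ts′} → ts ↭ ts′ → openings (codes ts) ≡ openings (codes ts′)
openings-codes-↭ p = ↭-length (filter-↭ (_≟ opening) (codes-↭ p))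

-- Balance of `code t` replaces its openings by closings. The cross term of `s` and `t` becomes a
-- product of two closing counts, which makes the whole expression symmetric in `s` and `t`.
inversions-codes-∷∷ : ∀ s t ts → inversions (codes (s ∷ t ∷ ts)) ≡
  inversions (code s) + (inversions (code t) + inversions (codes ts) + closings (code t) * openings (codes ts))
    + closings (code s) * (closings (code t) + openings (codes ts))
inversions-codes-∷∷ s t ts
  rewrite inversions-++ (code s) (code t ++ codes ts)
        | inversions-++ (code t) (codes ts)
        | count-++ (_≟ opening) (code t) (codes ts)
        | code-balanced t
        = refl

inversions-codes-swap : ∀ s t ts → inversions (codes (s ∷ t ∷ ts)) ≡ inversions (codes (t ∷ s ∷ ts))
inversions-codes-swap s t ts = begin
  inversions (codes (s ∷ t ∷ ts))
    ≡⟨ inversions-codes-∷∷ s t ts ⟩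
  _ ≡⟨ exchange (inversions (code s)) (inversions (code t)) (inversions (codes ts))
                (closings (code s)) (closings (code t)) (openings (codes ts)) ⟩
  _ ≡⟨ inversions-codes-∷∷ t s ts ⟨
  inversions (codes (t ∷ s ∷ ts)) ∎
  where
  exchange : ∀ is it i cs ct o → is + (it + i + ct * o) + cs * (ct + o) ≡ it + (is + i + cs * o) + ct * (cs + o)
  exchange = solve-∀

-- By `inversions-++`, the tail enters only through its inversions and its opening brackets, and a
-- permutation preserves the latter.
inversions-codes-∷ : ∀ t {ts ts′} → ts ↭ ts′ → inversions (codes ts) ≡ inversions (codes ts′) →
                     inversions (codes (t ∷ ts)) ≡ inversions (codes (t ∷ ts′))
inversions-codes-∷ t {ts} {ts′} p eq
  rewrite inversions-++ (code t) (codes ts) | inversions-++ (code t) (codes ts′)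
        | eq | openings-codes-↭ p
        = refl

inversions-codes-↭ : ∀ {ts ts′} → ts ↭ ts′ → inversions (codes ts) ≡ inversions (codes ts′)
inversions-codes-↭ refl                   = refl
inversions-codes-↭ (prep t p)             = inversions-codes-∷ t p (inversions-codes-↭ p)
-- The constructor `swap` also permutes the tail by `p`: the heads are exchanged first over the old
-- tail `ts`, then `p` is applied beneath both heads.
inversions-codes-↭ (swap {xs = ts} s t p) = ≡.trans (inversions-codes-swap s t ts)
  (inversions-codes-∷ t (prep s p) (inversions-codes-∷ s p (inversions-codes-↭ p)))
inversions-codes-↭ (trans p q)            = ≡.trans (inversions-codes-↭ p) (inversions-codes-↭ q)

-- The outer brackets take part in no inversion: nothing precedes the first, and nothing follows the
-- last.
inversions-code-node : ∀ ts → inversions (code (node ts)) ≡ inversions (codes ts)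
inversions-code-node ts = begin
  inversions (opening ∷ codes ts ++ [ closing ])
    ≡⟨ inversions-opening∷ (codes ts ++ [ closing ]) ⟩
  inversions (codes ts ++ [ closing ])
    ≡⟨ inversions-++ (codes ts) [ closing ] ⟩
  inversions (codes ts) + 0 + closings (codes ts) * 0
    ≡⟨ drop-zeros (inversions (codes ts)) (closings (codes ts)) ⟩
  inversions (codes ts) ∎
  where
  drop-zeros : ∀ i c → i + 0 + c * 0 ≡ i
  drop-zeros = solve-∀

inversions-levelOne : ∀ {T T′} → LevelOnePermutation T T′ → inversions (code T) ≡ inversions (code T′)
inversions-levelOne (permute {ts} {ts′} p) = begin
  inversions (code (node ts))  ≡⟨ inversions-code-node ts ⟩
  inversions (codes ts)        ≡⟨ inversions-codes-↭ p ⟩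
  inversions (codes ts′)       ≡⟨ inversions-code-node ts′ ⟨
  inversions (code (node ts′)) ∎

proposition2p1 : (T T′ : PRTree) → LevelOnePermutation T T′ → EvenTree T′ ⇔ EvenTree T
proposition2p1 T T′ p = mk⇔ (subst (2 ∣_) (sym eq)) (subst (2 ∣_) eq)
  where
  eq : inversions (code T) ≡ inversions (code T′)
  eq = inversions-levelOne p
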